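{- A structural abstract logic $\mathcal{S}$ in a propositional language $\mathcal{L}$ is couniform if, and only if, it is determined by a couniform bundle (equivalently, a couniform atlas) of $\mathcal{L}$-matrices, i.e. there is a couniform bundle $\mathcal{B}$ of $\mathcal{L}$-matrices with $\vdash_{\mathcal{S}}\,=\,\vdash_{\mathcal{B}}$.
   Context: $\mathcal{L}$ is an abstract propositional language, given by a set $\mathcal{V}_{\mathcal{L}}$ of variables, a set of constants and a set of finitary connectives. $\mathbf{Fm}_{\mathcal{L}}$ is the set of all $\mathcal{L}$-formulae; $\mathcal{V}(\alpha)$ is the set of variables occurring in $\alpha$, and $\mathcal{V}(X)=\bigcup_{\alpha\in X}\mathcal{V}(\alpha)$ for $X\subseteq\mathbf{Fm}_{\mathcal{L}}$. A structural abstract logic $\mathcal{S}$ is given by a (not necessarily finitary) consequence relation $\vdash_{\mathcal{S}}$ on $\mathbf{Fm}_{\mathcal{L}}$ (reflexive, monotone, transitive/closed under cut) closed under substitutions, equivalently by its consequence operator $\mathbf{Cn}_{\mathcal{S}}(X)=\{\alpha : X\vdash_{\mathcal{S}}\alpha\}$. A set $X$ is consistent if $\mathbf{Cn}_{\mathcal{S}}(X)\neq\mathbf{Fm}_{\mathcal{L}}$. $\mathcal{S}$ is couniform if for any collection $\{X_i\}_{i\in I}$ of formula sets with $\mathcal{V}(X_i)\cap\mathcal{V}(X_{i'})=\varnothing$ for $i\neq i'$ and $\mathcal{V}(\bigcup_{i\in I}X_i)\neq\mathcal{V}_{\mathcal{L}}$: if $\bigcup_{i\in I}X_i$ is inconsistent,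 then at least one $X_i$ is inconsistent. An $\mathcal{L}$-matrix is a pair $\mathbf{M}=\langle\mathbf{A},D\rangle$ with $\mathbf{A}$ an algebra of the signature of $\mathcal{L}$ and $D\subseteq|\mathbf{A}|$. $X\models_{\mathbf{M}}\alpha$ means: for every valuation $v$ in $\mathbf{A}$ (homomorphism from the formula algebra to $\mathbf{A}$), if $v[X]\subseteq D$ then $v[\alpha]\in D$. For a nonempty family $\mathcal{M}=\{\mathbf{M}_j\}_{j\in J}$, $X\vdash_{\mathcal{M}}\alpha$ iff $X\models_{\mathbf{M}_j}\alpha$ for each $j\in J$. A nonempty family of $\mathcal{L}$-matrices is a bundle if its algebras are pairwise isomorphic. An atlas is a pair $\langle\mathbf{A},\{D_i\}_{i\in I}\rangle$ with each $D_i\subseteq|\mathbf{A}|$; its corresponding bundle is $\{\langle\mathbf{A},D_i\rangle\}_{i\in I}$, and its consequence is that of the corresponding bundle. $\mathfrak{S}(\mathbf{M})$, for $\mathbf{M}=\langle\mathbf{A},D\rangle$, is the set of all $X\subseteq\mathbf{Fm}_{\mathcal{L}}$ such that $X=\{\alpha\in\mathbf{Fm}_{\mathcal{L}} : v[\alpha]\in D\}$ for some valuation $v$ in $\mathbf{A}$. A nonempty set $\{\mathbf{M}_j\}_{j\in J}$ of $\mathcal{L}$-matrices is couniform if for any collection $\{X_i\}_{i\in I}$ of formula sets with $\mathcal{V}(X_i)\cap\mathcal{V}(X_{i'})=\varnothing$ for $i\neq i'$ and $\mathcal{V}(\bigcup_{i\in I}X_i)\neq\mathcal{V}_{\mathcal{L}}$: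 if for every $i\in I$ there are $j\in J$ and $Z_j\in\mathfrak{S}(\mathbf{M}_j)$ with $X_i\subseteq Z_j\subsetneq\mathbf{Fm}_{\mathcal{L}}$, then there are $k\in J$ and $Z_k\in\mathfrak{S}(\mathbf{M}_k)$ with $\bigcup_{i\in I}X_i\subseteq Z_k\subsetneq\mathbf{Fm}_{\mathcal{L}}$. An atlas is couniform if its corresponding bundle is couniform. -}

module Defs where

open import Data.Nat.Base using (ℕ)
open import Data.Product.Base using (Σ-syntax; ∃-syntax; _×_; _,_)
open import Data.Vec.Base using (Vec; map)
open import Data.Vec.Properties using (map-id)
open import Data.Vec.Relation.Unary.Any using (Any)
open import Function.Base using (id)
open import Function.Bundles using (_⇔_)
open import Function.Definitions using (Bijective)
open import Level using (Level; suc)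
open import Relation.Binary.PropositionalEquality using (_≡_; _≢_; refl; sym; cong)
open import Relation.Nullary.Negation using (¬_)
open import Relation.Unary using (Pred; U; _∈_; _⊆_; _⊂_; _≐_; _∪_; _⊥_; ⋃)

private
  variable
    ℓ : Level

-- Sets of the classical theory are types in Set ℓ and their subsets are
-- predicates Pred _ ℓ, compared by the extensional equality _≐_.

record Language (ℓ : Level) : Set (suc ℓ) where
  field
    Var   : Set ℓ
    Const : Set ℓ
    Conn  : Set ℓ
    arity : Conn → ℕ

open Language

data Fm (L : Language ℓ) : Set ℓ where
  var : Var L → Fm L
  cst : Const L → Fm L
  con : (f : Conn L) → Vec (Fm L) (arity L f) → Fm L

data _occursIn_ {L : Language ℓ} (x : Var L) : Fm L → Set ℓ where
  here  : x occursIn var x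
  there : ∀ {f αs} → Any (x occursIn_) αs → x occursIn con f αs

FmSet : Language ℓ → Set (suc ℓ)
FmSet {ℓ} L = Pred (Fm L) ℓ

𝒱 : {L : Language ℓ} → FmSet L → Pred (Var L) ℓ
𝒱 X x = ∃[ α ] (α ∈ X × x occursIn α)

record Algebra (L : Language ℓ) : Set (suc ℓ) where
  field
    Carrier : Set ℓ
    ⟦_⟧ᶜ    : Const L → Carrier
    ⟦_⟧     : (f : Conn L) → Vec Carrier (arity L f) → Carrier

open Algebra

𝐅𝐦 : (L : Language ℓ) → Algebra L
𝐅𝐦 L = record { Carrier = Fm L ; ⟦_⟧ᶜ = cst ; ⟦_⟧ = con }

record Hom {L : Language ℓ} (𝐀 𝐁 : Algebra L) : Set ℓ where
  field
    to       : Carrier 𝐀 → Carrier 𝐁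
    to-const : ∀ c → to (⟦ 𝐀 ⟧ᶜ c) ≡ ⟦ 𝐁 ⟧ᶜ c
    to-conn  : ∀ f xs → to (⟦ 𝐀 ⟧ f xs) ≡ ⟦ 𝐁 ⟧ f (map to xs)

open Hom

_≅_ : {L : Language ℓ} → Algebra L → Algebra L → Set ℓ
𝐀 ≅ 𝐁 = Σ[ h ∈ Hom 𝐀 𝐁 ] Bijective _≡_ _≡_ (to h)

≅-refl : {L : Language ℓ} {𝐀 : Algebra L} → 𝐀 ≅ 𝐀
≅-refl {𝐀 = 𝐀} =
  record
    { to       = id
    ; to-const = λ _ → refl
    ; to-conn  = λ f xs → cong (⟦ 𝐀 ⟧ f) (sym (map-id xs))
    }
  , id , λ y → y , id

Valuation : {L : Language ℓ} → Algebra L → Set ℓ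
Valuation {L = L} 𝐀 = Hom (𝐅𝐦 L) 𝐀

Substitution : Language ℓ → Set ℓ
Substitution L = Valuation (𝐅𝐦 L)

_[_] : {L : Language ℓ} {𝐀 : Algebra L} → Valuation 𝐀 → FmSet L → Pred (Carrier 𝐀) ℓ
(v [ X ]) y = ∃[ α ] (α ∈ X × to v α ≡ y)

record StructuralLogic (L : Language ℓ) : Set (suc ℓ) where
  infix 4 _⊢_
  field
    _⊢_        : FmSet L → Fm L → Set ℓ
    reflexive  : ∀ {X : FmSet L} {α} → α ∈ X → X ⊢ α
    monotone   : ∀ {X Y : FmSet L} {α} → X ⊆ Y → X ⊢ α → Y ⊢ α
    cut        : ∀ {X Y : FmSet L} {α} → (∀ {β} → β ∈ Y → X ⊢ β) → X ∪ Y ⊢ α → X ⊢ α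
    structural : ∀ (σ : Substitution L) {X : FmSet L} {α} → X ⊢ α → σ [ X ] ⊢ to σ α

  Cn : FmSet L → FmSet L
  Cn X α = X ⊢ α

  Inconsistent : FmSet L → Set ℓ
  Inconsistent X = Cn X ≐ U

open StructuralLogic using (Inconsistent)

Separated : {L : Language ℓ} (I : Set ℓ) → (I → FmSet L) → Set ℓ
Separated I X = (∀ i i′ → i ≢ i′ → 𝒱 (X i) ⊥ 𝒱 (X i′)) × ¬ (𝒱 (⋃ I X) ≐ U)

CouniformLogic : {L : Language ℓ} → StructuralLogic L → Set (suc ℓ)
CouniformLogic {ℓ} {L} S =
  (I : Set ℓ) (X : I → FmSet L) → Separated I X →
  Inconsistent S (⋃ I X) → ∃[ i ] Inconsistent S (X i)

record Matrix (L : Language ℓ) : Set (suc ℓ) where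
  constructor ⟨_,_⟩
  field
    algebra    : Algebra L
    designated : Pred (Carrier algebra) ℓ

_⊨[_]_ : {L : Language ℓ} → FmSet L → Matrix L → Fm L → Set ℓ
X ⊨[ M ] α = (v : Valuation algebra) → v [ X ] ⊆ designated → to v α ∈ designated
  where open Matrix M

𝔖 : {L : Language ℓ} → Matrix L → Pred (FmSet L) ℓ
𝔖 M Z = Σ[ v ∈ Valuation algebra ] Z ≐ (λ α → to v α ∈ designated)
  where open Matrix M

-- Index sets lie in Set (suc ℓ), so that a family may be indexed by all
-- sets of formulae; index sets in Set ℓ are included up to lifting.
record Family (L : Language ℓ) : Set (suc (suc ℓ)) where
  field
    Index    : Set (suc ℓ)
    nonempty : Index
    matrix   : Index → Matrix L

_⊢[_]_ : {L : Language ℓ} → FmSet L → Family L → Fm L → Set (suc ℓ)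
X ⊢[ 𝓜 ] α = ∀ j → X ⊨[ Family.matrix 𝓜 j ] α

CouniformFamily : {L : Language ℓ} → Family L → Set (suc ℓ)
CouniformFamily {ℓ} {L} 𝓜 =
  (I : Set ℓ) (X : I → FmSet L) → Separated I X →
  (∀ i → ∃[ j ] ∃[ Z ] (Z ∈ 𝔖 (matrix j) × X i ⊆ Z × Z ⊂ U)) →
  ∃[ k ] ∃[ Z ] (Z ∈ 𝔖 (matrix k) × ⋃ I X ⊆ Z × Z ⊂ U)
  where open Family 𝓜

_DeterminedBy_ : {L : Language ℓ} → StructuralLogic L → Family L → Set (suc ℓ)
S DeterminedBy 𝓜 = ∀ X α → (X ⊢ α) ⇔ (X ⊢[ 𝓜 ] α)
  where open StructuralLogic S

record Bundle (L : Language ℓ) : Set (suc (suc ℓ)) where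
  field
    family : Family L

  open Family family

  field
    isomorphic : ∀ i j → Matrix.algebra (matrix i) ≅ Matrix.algebra (matrix j)

record Atlas (L : Language ℓ) : Set (suc (suc ℓ)) where
  field
    algebra    : Algebra L
    Index      : Set (suc ℓ)
    nonempty   : Index
    designated : Index → Pred (Carrier algebra) ℓ

  bundle : Bundle L
  bundle = record
    { family = record
      { Index    = Index
      ; nonempty = nonempty
      ; matrix   = λ i → ⟨ algebra , designated i ⟩
      }
    ; isomorphic = λ _ _ → ≅-refl
    }

CouniformBundle : {L : Language ℓ} → Bundle L → Set (suc ℓ)
CouniformBundle 𝓑 = CouniformFamily (Bundle.family 𝓑)

CouniformAtlas : {L : Language ℓ} → Atlas L → Set (suc ℓ)
CouniformAtlas 𝓐 = CouniformBundle (Atlas.bundle 𝓐)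

{-# OPTIONS --safe #-}

-- A couniform logic is determined by its Lindenbaum atlas, consisting of the
-- formula algebra and all theories Cn Y. A set of formulae lies in a proper
-- member of 𝔖 of this atlas exactly when it is consistent, since preimages of
-- theories under substitutions are theories; so the two notions of
-- couniformity say the same. The same characterisation of consistency holds,
-- by excluded middle, for any family of matrices determining the logic.
module Submission where

open import Axiom.DoubleNegationElimination using (em⇒dne)
open import Axiom.ExcludedMiddle using (ExcludedMiddle)
open import Data.Product.Base using (Σ-syntax; ∃-syntax; _×_; _,_; proj₁)
open import Data.Sum.Base using (inj₂)
open import Function.Bundles using (_⇔_; mk⇔; Equivalence)
open import Level using (Level; suc; lift; lower)
open import Relation.Binary.PropositionalEquality using (refl)
open import Relation.Nullary.Decidable using (map′)
open import Relation.Nullary.Negation using (¬_)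
open import Relation.Unary using (_∈_; _⊆_; _⊂_; U; ⋃)
open import Relation.Unary.Polymorphic using (∅)
open import Relation.Unary.Properties using (≐-refl)
open import Defs

private
  variable
    ℓ : Level
    L : Language ℓ

Extendable : Family L → FmSet L → Set _
Extendable 𝓜 X = ∃[ j ] ∃[ Z ] (Z ∈ 𝔖 (Family.matrix 𝓜 j) × X ⊆ Z × Z ⊂ U)

lower-em : ExcludedMiddle (suc ℓ) → ExcludedMiddle ℓ
lower-em em = map′ lower lift em

module _ (S : StructuralLogic L) where

  open StructuralLogic S

  lindenbaum : Atlas L
  lindenbaum = record
    { algebra    = 𝐅𝐦 L
    ; Index      = FmSet L
    ; nonempty   = ∅
    ; designated = Cn
    }

  lindenbaumFamily : Family L
  lindenbaumFamily = Bundle.family (Atlas.bundle lindenbaum)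

  idSubstitution : Substitution L
  idSubstitution = proj₁ ≅-refl

  -- Structurality carries the derivation over to `σ [ X ]`, and `cut` then removes these premises,
  -- all of which `Y` derives.
  preimage-closed : ∀ (σ : Substitution L) X Y {α} →
    σ [ X ] ⊆ Cn Y → X ⊢ α → Y ⊢ Hom.to σ α
  preimage-closed σ X Y σX⊆CnY X⊢α =
    cut {Y} {σ [ X ]} σX⊆CnY (monotone {σ [ X ]} inj₂ (structural σ X⊢α))

  lindenbaum-determines : S DeterminedBy lindenbaumFamily
  lindenbaum-determines X α = mk⇔ sound complete
    where
    sound : X ⊢ α → X ⊢[ lindenbaumFamily ] α
    sound X⊢α Y σ σX⊆CnY = preimage-closed σ X Y σX⊆CnY X⊢α

    -- A single test suffices: the theory of `X` itself under the identity valuation.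
    complete : X ⊢[ lindenbaumFamily ] α → X ⊢ α
    complete X⊨α = X⊨α X idSubstitution λ { (β , β∈X , refl) → reflexive β∈X }

  -- The valuation behind `Z` designates all of `X`; if `X` were inconsistent, it would designate
  -- every formula, and `Z` would not be proper.
  extendable⇒consistent : ∀ 𝓜 → S DeterminedBy 𝓜 → ∀ X →
    Extendable 𝓜 X → ¬ Inconsistent X
  extendable⇒consistent 𝓜 det X (j , Z , (v , Z⊆ , Z⊇) , X⊆Z , (_ , Z≢U)) (_ , U⊆CnX) =
    Z≢U λ {α} _ → Z⊇ (Equivalence.to (det X α) (U⊆CnX _) j v
      λ { (β , β∈X , refl) → Z⊆ (X⊆Z β∈X) })

  consistent⇒lindenbaum-extendable : ∀ X →
    ¬ Inconsistent X → Extendable lindenbaumFamily X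
  consistent⇒lindenbaum-extendable X consistent =
    X , Cn X , (idSubstitution , ≐-refl) , reflexive
      , ((λ {_} _ → _) , λ U⊆CnX → consistent ((λ {_} _ → _) , U⊆CnX))

  -- By contraposition: if no valuation designating `X` omits a formula, then `X` entails every
  -- formula in every matrix. Excluded middle is taken one level up because `Extendable` ranges over
  -- indices and formula sets.
  consistent⇒extendable : ExcludedMiddle (suc _) → ∀ 𝓜 → S DeterminedBy 𝓜 →
    ∀ X → ¬ Inconsistent X → Extendable 𝓜 X
  consistent⇒extendable em 𝓜 det X consistent = em⇒dne em λ ¬extendable →
    consistent ((λ {_} _ → _) , λ {α} _ → Equivalence.from (det X α) λ j v vX⊆D →
      em⇒dne (lower-em em) λ vα∉D → ¬extendable
        -- The set left implicit consists of the formulae that `v` designates; it is proper because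
        -- it omits `α`.
        ( j , _ , (v , ≐-refl)
        , (λ {β} β∈X → vX⊆D (β , β∈X , refl))
        , ((λ {_} _ → _) , λ U⊆Z → vα∉D (U⊆Z _)) ))

  lindenbaum-couniform : CouniformLogic S → CouniformAtlas lindenbaum
  lindenbaum-couniform couniform I X separated extendable =
    consistent⇒lindenbaum-extendable (⋃ I X) λ inconsistent →
      let i , Xᵢ-inconsistent = couniform I X separated inconsistent
      in extendable⇒consistent lindenbaumFamily lindenbaum-determines (X i)
           (extendable i) Xᵢ-inconsistent

  -- Were every `X i` consistent, each would be extendable, hence so would their union by
  -- couniformity of `𝓜`, contradicting its inconsistency.
  determined⇒couniform : ExcludedMiddle (suc _) → ∀ 𝓜 →
    CouniformFamily 𝓜 → S DeterminedBy 𝓜 → CouniformLogic S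
  determined⇒couniform em 𝓜 couniform det I X separated inconsistent =
    em⇒dne (lower-em em) λ allConsistent →
      extendable⇒consistent 𝓜 det (⋃ I X)
        (couniform I X separated λ i →
          consistent⇒extendable em 𝓜 det (X i) λ Xᵢ-inconsistent → allConsistent (i , Xᵢ-inconsistent))
        inconsistent

corollary3p2p1 : ∀ {ℓ : Level} → ExcludedMiddle (suc ℓ) → (L : Language ℓ) (S : StructuralLogic L) →
    (CouniformLogic S ⇔ (Σ[ 𝓑 ∈ Bundle L ] (CouniformBundle 𝓑 × S DeterminedBy Bundle.family 𝓑)))
    × (CouniformLogic S ⇔ (Σ[ 𝓐 ∈ Atlas L ] (CouniformAtlas 𝓐 × S DeterminedBy Bundle.family (Atlas.bundle 𝓐))))
corollary3p2p1 em L S =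
    mk⇔ (λ couniform → Atlas.bundle (lindenbaum S) , lindenbaum-couniform S couniform , lindenbaum-determines S)
        (λ (𝓑 , couniform , det) → determined⇒couniform S em (Bundle.family 𝓑) couniform det)
  , mk⇔ (λ couniform → lindenbaum S , lindenbaum-couniform S couniform , lindenbaum-determines S)
        (λ (𝓐 , couniform , det) → determined⇒couniform S em (Bundle.family (Atlas.bundle 𝓐)) couniform det)
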